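{- Let $r \geq 2$, let $H$ be a digraph (possibly with loops), and let $D$ be an $H$-colored $r$-quasi-transitive digraph such that every directed cycle of length $r+1$ in $D$ is an $H$-cycle. Let $u,v\in V(D)$. If $d_{D}(u,v) \geq r$ and $T$ is a shortest directed $uv$-path in $D$, then $T$ is an $H$-path.
   Context: All digraphs are finite. A digraph $D$ is $r$-quasi-transitive if for all distinct $u,v\in V(D)$, whenever there is a directed $uv$-path of length $r$, $u$ and $v$ are joined by an arc (in some direction). $d_D(u,v)$ is the length of a shortest directed $uv$-path (here it is assumed a $uv$-path exists). $D$ has no loops and comes with a map $\rho: A(D)\to V(H)$. For a walk $W=(x_0,\ldots,x_n)$ in $D$, there is an obstruction on $x_i$ if $(\rho(x_{i-1},x_i),\rho(x_i,x_{i+1})) \notin A(H)$; for an open walk this is considered at internal vertices $x_i$, $1\le i\le n-1$, for a closed walk at all $i\in\{0,\ldots,n-1\}$ with indices modulo $n$. An $H$-path is a directed path with no obstructions (the colours of consecutive arcs form a directed walk in $H$); an $H$-cycle is a directed cycle with no obstructions, taken cyclically. -}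

module Defs where

open import Data.Bool using (Bool; T)
open import Data.Fin using (Fin; zero; suc; toℕ; fromℕ; inject₁)
open import Data.Nat using (ℕ; suc; _≤_; _%_; NonZero)
open import Data.Product using (Σ; ∃; _×_)
open import Data.Sum using (_⊎_)
open import Function using (_∘_)
open import Function.Definitions using (Injective)
open import Relation.Binary.PropositionalEquality using (_≡_; _≢_)
open import Relation.Nullary using (¬_)

-- Finite digraphs without parallel arcs; loops are allowed.
-- The Boolean adjacency makes arcs decidable and proof-irrelevant, so a
-- map out of the arcs depends only on their end-vertices.
record Digraph : Set where
  field
    order : ℕ
    adj   : Fin order → Fin order → Bool

  V : Set
  V = Fin order

  Arc : V → V → Set
  Arc u v = T (adj u v)

open Digraph public using (V; Arc)

Loopless : Digraph → Set
Loopless D = ∀ (v : V D) → ¬ Arc D v v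

-- A walk (x₀ , … , xₙ); `arc i` goes from xᵢ to xᵢ₊₁.
record Walk (D : Digraph) (n : ℕ) : Set where
  field
    vertex : Fin (suc n) → V D
    arc    : ∀ (i : Fin n) → Arc D (vertex (inject₁ i)) (vertex (suc i))

open Walk public

record Joins {D : Digraph} {n : ℕ} (u v : V D) (W : Walk D n) : Set where
  field
    start : vertex W zero ≡ u
    end   : vertex W (fromℕ n) ≡ v

IsPath : ∀ {D n} → Walk D n → Set
IsPath W = Injective _≡_ _≡_ (vertex W)

record IsCycle {D : Digraph} {n : ℕ} .{{_ : NonZero n}} (W : Walk D n) : Set where
  field
    closed   : vertex W zero ≡ vertex W (fromℕ n)
    distinct : Injective _≡_ _≡_ (vertex W ∘ inject₁)

Path : (D : Digraph) → V D → V D → ℕ → Set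
Path D u v n = Σ (Walk D n) λ W → Joins u v W × IsPath W

QuasiTransitive : ℕ → Digraph → Set
QuasiTransitive r D =
  ∀ (u v : V D) → u ≢ v → Path D u v r → Arc D u v ⊎ Arc D v u

IsShortest : ∀ {D u v n} → Path D u v n → Set
IsShortest {D} {u} {v} {n} _ = ∀ m → Path D u v m → n ≤ m

-- Distance as a relation, since it is defined only when a uv-path exists.
IsDistance : (D : Digraph) → V D → V D → ℕ → Set
IsDistance D u v d = Σ (Path D u v d) IsShortest

record HColored (H : Digraph) : Set where
  field
    digraph  : Digraph
    loopless : Loopless digraph
    ρ        : ∀ (u v : V digraph) → Arc digraph u v → V H

open HColored public using (digraph)

module _ {H : Digraph} (D : HColored H) where
  open HColored D using (ρ)

  colour : ∀ {n} → Walk (digraph D) n → Fin n → V H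
  colour W i = ρ (vertex W (inject₁ i)) (vertex W (suc i)) (arc W i)

  -- Obstruction on xᵢ, where arc p enters xᵢ and arc i leaves it.  Such a p
  -- exists, for i < n, exactly when 1 ≤ i ≤ n - 1, i.e. when xᵢ is internal.
  OpenObstruction : ∀ {n} → Walk (digraph D) n → Fin n → Set
  OpenObstruction {n} W i = ∃ λ (p : Fin n) →
    toℕ i ≡ suc (toℕ p) × ¬ Arc H (colour W p) (colour W i)

  ClosedObstruction : ∀ {n} .{{_ : NonZero n}} → Walk (digraph D) n → Fin n → Set
  ClosedObstruction {n} W i = ∃ λ (p : Fin n) →
    toℕ i ≡ suc (toℕ p) % n × ¬ Arc H (colour W p) (colour W i)

  IsHPath : ∀ {n} → Walk (digraph D) n → Set
  IsHPath W = IsPath W × (∀ i → ¬ OpenObstruction W i)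

  IsHCycle : ∀ {n} .{{_ : NonZero n}} → Walk (digraph D) n → Set
  IsHCycle W = IsCycle W × (∀ i → ¬ ClosedObstruction W i)

{-# OPTIONS --safe #-}
-- Any two consecutive arcs of T lie in a window x_s , … , x_{s+r} of T, since
-- T has length at least r.  By r-quasi-transitivity the ends of the window
-- are joined by an arc.  It cannot point forward, for it would shorten T;
-- so it points backward and closes the window to a cycle of length r + 1,
-- which has no obstruction where the two given arcs meet.
module Submission where

open import Data.Bool.Properties using (T-irrelevant)
open import Data.Empty using (⊥-elim)
open import Data.Fin using (Fin; zero; suc; toℕ; fromℕ; fromℕ<; inject₁)
open import Data.Fin.Properties
  using (toℕ-injective; toℕ-fromℕ; toℕ-fromℕ<; toℕ-inject₁; toℕ<n; toℕ≤pred[n])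
open import Data.Nat using (ℕ; suc; z≤n; s≤s; s≤s⁻¹; _+_; _∸_; _⊓_; _%_; _≤_; _<_; _≤?_)
open import Data.Nat.DivMod using (m<n⇒m%n≡m; n%n≡0)
open import Data.Nat.Properties
open import Data.Product using (∃; _×_; _,_; proj₁; proj₂)
open import Data.Sum using (inj₁; inj₂)
open import Function using (_∘_)
open import Relation.Binary.Definitions using (tri<; tri≈; tri>)
open import Relation.Binary.PropositionalEquality
open import Relation.Nullary using (¬_; yes; no)
open import Defs

-- Walks indexed by natural numbers

-- Truncating at `n` makes the indexing total, so that positions can be added and shifted as natural
-- numbers; bounds are needed only where the actual value matters.
clamp : ∀ n → ℕ → Fin (suc n)
clamp n k = fromℕ< (s≤s (m⊓n≤n k n))

toℕ-clamp : ∀ {n k} → k ≤ n → toℕ (clamp n k) ≡ k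
toℕ-clamp {n} {k} k≤n = trans (toℕ-fromℕ< (s≤s (m⊓n≤n k n))) (m≤n⇒m⊓n≡m k≤n)

module _ {D : Digraph} where

  fromSequence : ∀ {n} (x : ℕ → V D) →
    (∀ k → k < n → Arc D (x k) (x (suc k))) → Walk D n
  fromSequence x a = record
    { vertex = x ∘ toℕ
    ; arc    = λ i → subst (λ k → Arc D (x k) (x (suc (toℕ i))))
                       (sym (toℕ-inject₁ i)) (a (toℕ i) (toℕ<n i))
    }

  -- Constant from index n on.
  at : ∀ {n} → Walk D n → ℕ → V D
  at {n} W k = vertex W (clamp n k)

  at-toℕ : ∀ {n} (W : Walk D n) (i : Fin (suc n)) → at W (toℕ i) ≡ vertex W i
  at-toℕ W i = cong (vertex W) (toℕ-injective (toℕ-clamp (toℕ≤pred[n] i)))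

  at-inject₁ : ∀ {n} (W : Walk D n) (i : Fin n) →
    at W (toℕ i) ≡ vertex W (inject₁ i)
  at-inject₁ W i = trans (cong (at W) (sym (toℕ-inject₁ i))) (at-toℕ W (inject₁ i))

  at-end : ∀ {n} (W : Walk D n) → at W n ≡ vertex W (fromℕ n)
  at-end {n} W = trans (cong (at W) (sym (toℕ-fromℕ n))) (at-toℕ W (fromℕ n))

  at-arc : ∀ {n} (W : Walk D n) k → k < n → Arc D (at W k) (at W (suc k))
  at-arc W k k<n = subst (λ m → Arc D (at W m) (at W (suc m))) (toℕ-fromℕ< k<n)
    (subst₂ (Arc D) (sym (at-inject₁ W i)) (sym (at-toℕ W (suc i))) (arc W i))
    where i = fromℕ< k<n

  at-injective : ∀ {n} (W : Walk D n) → IsPath W →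
    ∀ {j k} → j ≤ n → k ≤ n → at W j ≡ at W k → j ≡ k
  at-injective {n} W path {j} {k} j≤n k≤n eq = begin
    j                  ≡⟨ toℕ-clamp j≤n ⟨
    toℕ (clamp n j)    ≡⟨ cong toℕ (path eq) ⟩
    toℕ (clamp n k)    ≡⟨ toℕ-clamp k≤n ⟩
    k                  ∎
    where open ≡-Reasoning

  -- Segments and shortcuts of a path

  segment : ∀ {n} (W : Walk D n) → IsPath W → ∀ s r → s + r ≤ n →
    Path D (at W s) (at W (s + r)) r
  segment {n} W path s r s+r≤n = walk , joins , injective
    where
    in-range : ∀ (i : Fin (suc r)) → s + toℕ i ≤ n
    in-range i = ≤-trans (+-monoʳ-≤ s (toℕ≤pred[n] i)) s+r≤n

    walk : Walk D r
    walk = fromSequence (λ k → at W (s + k)) λ k k<r →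
      subst (λ m → Arc D (at W (s + k)) (at W m)) (sym (+-suc s k))
        (at-arc W (s + k) (<-≤-trans (+-monoʳ-< s k<r) s+r≤n))

    joins : Joins (at W s) (at W (s + r)) walk
    joins = record
      { start = cong (at W) (+-identityʳ s)
      ; end   = cong (λ k → at W (s + k)) (toℕ-fromℕ r)
      }

    injective : IsPath walk
    injective {i} {j} eq = toℕ-injective (+-cancelˡ-≡ s _ _
      (at-injective W path (in-range i) (in-range j) eq))

  -- Follow the path up to position `s`, take the given arc, and continue along the last `t` arcs.
  -- The `q` vertices strictly between the ends of the arc are left out, so `skip` shifts every
  -- index beyond `s` by `q`.
  shortcut : ∀ {n u v} → ((W , _) : Path D u v n) → ∀ s q t → s + suc q + t ≡ n →
    Arc D (at W s) (at W (s + suc q)) → Path D u v (suc (s + t))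
  shortcut {u = u} {v} (W , W-joins , path) s q t refl a = walk , joins , injective
    where
    skip : ℕ → ℕ
    skip k with k ≤? s
    ... | yes _ = k
    ... | no _  = q + k

    skip-≤ : ∀ {k} → k ≤ s → skip k ≡ k
    skip-≤ {k} k≤s with k ≤? s
    ... | yes _  = refl
    ... | no k≰s = ⊥-elim (k≰s k≤s)

    skip-> : ∀ {k} → s < k → skip k ≡ q + k
    skip-> {k} s<k with k ≤? s
    ... | yes k≤s = ⊥-elim (<⇒≱ s<k k≤s)
    ... | no _    = refl

    length-eq : q + suc (s + t) ≡ s + suc q + t
    length-eq = begin
      q + suc (s + t)   ≡⟨ +-suc q (s + t) ⟩
      suc q + (s + t)   ≡⟨ +-assoc (suc q) s t ⟨
      suc q + s + t     ≡⟨ cong (_+ t) (+-comm (suc q) s) ⟩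
      s + suc q + t     ∎
      where open ≡-Reasoning

    shifted≤n : ∀ {k} → k ≤ suc (s + t) → q + k ≤ s + suc q + t
    shifted≤n k≤ = ≤-trans (+-monoʳ-≤ q k≤) (≤-reflexive length-eq)

    skip≤n : ∀ {k} → k ≤ suc (s + t) → skip k ≤ s + suc q + t
    skip≤n {k} k≤ with k ≤? s
    ... | yes _ = ≤-trans (m≤n+m k q) (shifted≤n k≤)
    ... | no _  = shifted≤n k≤

    skip-injective : ∀ {j k} → skip j ≡ skip k → j ≡ k
    skip-injective {j} {k} eq with j ≤? s | k ≤? s
    ... | yes _   | yes _   = eq
    ... | no _    | no _    = +-cancelˡ-≡ q _ _ eq
    -- The mixed cases cannot occur: a shift never lowers an index, so an index beyond `s` keeps its
    -- image beyond `s`.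
    ... | yes j≤s | no k≰s  = ⊥-elim (k≰s (≤-trans (m≤n+m k q) (subst (_≤ s) eq j≤s)))
    ... | no j≰s  | yes k≤s = ⊥-elim (j≰s (≤-trans (m≤n+m j q) (subst (_≤ s) (sym eq) k≤s)))

    skip-arc : ∀ k → k < suc (s + t) → Arc D (at W (skip k)) (at W (skip (suc k)))
    skip-arc k k<m with <-cmp k s
    ... | tri< k<s _ _ rewrite skip-≤ (<⇒≤ k<s) | skip-≤ k<s =
      at-arc W k (<-≤-trans k<s (≤-trans (m≤m+n s (suc q)) (m≤m+n (s + suc q) t)))
    -- Only the step out of position `s` uses the new arc.
    ... | tri≈ _ refl _ rewrite skip-≤ (≤-refl {k}) | skip-> (n<1+n k) =
      subst (λ m → Arc D (at W k) (at W m)) (trans (+-comm k (suc q)) (sym (+-suc q k))) a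
    ... | tri> _ _ s<k rewrite skip-> s<k | skip-> (m<n⇒m<1+n s<k) | +-suc q k =
      at-arc W (q + k) (subst (_≤ s + suc q + t) (+-suc q k) (shifted≤n k<m))

    walk : Walk D (suc (s + t))
    walk = fromSequence (at W ∘ skip) skip-arc

    joins : Joins u v walk
    joins = record
      { start = trans (cong (at W) (skip-≤ z≤n)) (trans (at-toℕ W zero) (Joins.start W-joins))
      ; end   = begin
          at W (skip (toℕ (fromℕ (suc (s + t)))))  ≡⟨ cong (at W ∘ skip) (toℕ-fromℕ (suc (s + t))) ⟩
          at W (skip (suc (s + t)))                ≡⟨ cong (at W) (skip-> (s≤s (m≤m+n s t))) ⟩
          at W (q + suc (s + t))                   ≡⟨ cong (at W) length-eq ⟩
          at W (s + suc q + t)                     ≡⟨ at-end W ⟩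
          vertex W (fromℕ (s + suc q + t))         ≡⟨ Joins.end W-joins ⟩
          v                                        ∎
      }
      where open ≡-Reasoning

    injective : IsPath walk
    injective {i} {j} eq = toℕ-injective (skip-injective
      (at-injective W path (skip≤n (toℕ≤pred[n] i)) (skip≤n (toℕ≤pred[n] j)) eq))

  -- Closing a window to a cycle

  backward-arc : ∀ {r n u v} → 2 ≤ r → QuasiTransitive r D →
    (P@(W , _) : Path D u v n) → IsShortest P → ∀ s t → s + r + t ≡ n →
    Arc D (at W (s + r)) (at W s)
  backward-arc {r@(suc r-1)} {n} 2≤r quasi P@(W , _ , path) shortest s t s+r+t≡n
    with quasi (at W s) (at W (s + r)) ends-distinct (segment W path s r s+r≤n)
    where
    s+r≤n : s + r ≤ n
    s+r≤n = subst (s + r ≤_) s+r+t≡n (m≤m+n (s + r) t)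

    ends-distinct : at W s ≢ at W (s + r)
    ends-distinct eq = m≢1+m+n s (trans
      (at-injective W path (≤-trans (m≤m+n s r) s+r≤n) s+r≤n eq) (+-suc s r-1))
  ... | inj₂ backward = backward
  ... | inj₁ forward  =
    ⊥-elim (<⇒≱ shorter (shortest _ (shortcut P s r-1 t s+r+t≡n forward)))
    where
    shorter : suc (s + t) < n
    shorter = begin-strict
      suc (s + t)    ≡⟨ cong (_+ t) (+-comm 1 s) ⟩
      -- One arc replaces `r` arcs, which is a strict gain because `r` is at least 2.
      s + 1 + t      <⟨ +-monoˡ-< t (+-monoʳ-< s 2≤r) ⟩
      s + r + t      ≡⟨ s+r+t≡n ⟩
      n              ∎
      where open ≤-Reasoning

  -- Index r + 1 of the cycle is sent back to 0 by the reduction modulo r + 1.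
  close : ∀ {r u v} → ((W , _) : Path D u v r) → Arc D v u → Walk D (suc r)
  close {r} (W , joins , _) a = fromSequence (λ k → at W (k % suc r)) arcs
    where
    arcs : ∀ k → k < suc r → Arc D (at W (k % suc r)) (at W (suc k % suc r))
    arcs k k≤r rewrite m<n⇒m%n≡m k≤r with m≤n⇒m<n∨m≡n k≤r
    ... | inj₁ k<r rewrite m<n⇒m%n≡m k<r = at-arc W k (s≤s⁻¹ k<r)
    -- The last step leaves the end of the path and wraps around to its start, along `a`.
    ... | inj₂ refl rewrite n%n≡0 (suc r) {{_}} = subst₂ (Arc D)
      (sym (trans (at-end W) (Joins.end joins)))
      (sym (trans (at-toℕ W zero) (Joins.start joins))) a

  -- Distinctness concerns only the indices up to `r`; reduction modulo `suc r` fixes these, so it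
  -- is inherited from the path.
  close-isCycle : ∀ {r u v} (P : Path D u v r) (a : Arc D v u) → IsCycle (close P a)
  close-isCycle {r} (W , _ , path) a = record
    { closed   = cong (at W) (sym (trans (cong (_% suc r) (toℕ-fromℕ (suc r))) (n%n≡0 (suc r))))
    ; distinct = λ {i} {j} eq → toℕ-injective (at-injective W path
        (toℕ≤pred[n] i) (toℕ≤pred[n] j)
        (subst₂ (λ k l → at W k ≡ at W l) (reduced i) (reduced j) eq))
    }
    where
    reduced : ∀ (i : Fin (suc r)) → toℕ (inject₁ i) % suc r ≡ toℕ i
    reduced i = trans (cong (_% suc r) (toℕ-inject₁ i)) (m<n⇒m%n≡m (toℕ<n i))

  at-close : ∀ {r u v} (P : Path D u v r) (a : Arc D v u) {k} → k ≤ r →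
    at (close P a) k ≡ at (proj₁ P) k
  at-close {r} (W , _) a {k} k≤r = cong (at W) (begin
    toℕ (clamp (suc r) k) % suc r  ≡⟨ cong (_% suc r) (toℕ-clamp (m≤n⇒m≤1+n k≤r)) ⟩
    k % suc r                      ≡⟨ m<n⇒m%n≡m (s≤s k≤r) ⟩
    k                              ∎)
    where open ≡-Reasoning

  at-segment : ∀ {n} (W : Walk D n) (path : IsPath W) s r (s+r≤n : s + r ≤ n) {k} → k ≤ r →
    at (proj₁ (segment W path s r s+r≤n)) k ≡ at W (s + k)
  at-segment W path s r _ k≤r = cong (λ m → at W (s + m)) (toℕ-clamp k≤r)

-- Comparing colours, and placing the window

module _ {H : Digraph} (D : HColored H) where
  open HColored D using (ρ)

  -- Once the end-vertices are identified, the two arc witnesses agree by proof irrelevance of `T`.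
  ρ-cong : ∀ {u u′ v v′} (a : Arc (digraph D) u v) (a′ : Arc (digraph D) u′ v′) →
    u ≡ u′ → v ≡ v′ → ρ u v a ≡ ρ u′ v′ a′
  ρ-cong a a′ refl refl = cong (ρ _ _) (T-irrelevant a a′)

  colour-cong : ∀ {m n} (W : Walk (digraph D) m) (W′ : Walk (digraph D) n)
    (i : Fin m) (j : Fin n) →
    at W (toℕ i) ≡ at W′ (toℕ j) → at W (suc (toℕ i)) ≡ at W′ (suc (toℕ j)) →
    colour D W i ≡ colour D W′ j
  colour-cong W W′ i j eq eq′ = ρ-cong (arc W i) (arc W′ j)
    (trans (sym (at-inject₁ W i)) (trans eq (at-inject₁ W′ j)))
    (trans (sym (at-toℕ W (suc i))) (trans eq′ (at-toℕ W′ (suc j))))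

-- Start the window at `p` if it fits before `n`; otherwise take the last window, which ends at `n`.
-- Here `q` is the offset of arc `p`, and `suc q < r` says that the following arc is in the window
-- too.
window : ∀ {r n p} → 2 ≤ r → r ≤ n → suc p < n →
  ∃ λ s → ∃ λ q → ∃ λ t → p ≡ s + q × suc q < r × s + r + t ≡ n
window {r} {n} {p} 2≤r r≤n p+1<n with p + r ≤? n
... | yes p+r≤n = p , 0 , n ∸ (p + r) , sym (+-identityʳ p) , 2≤r , m+[n∸m]≡n p+r≤n
... | no p+r≰n = s , p ∸ s , 0 , sym s+q≡p , q+1<r , trans (+-identityʳ (s + r)) s+r≡n
  where
  s = n ∸ r

  s+r≡n : s + r ≡ n
  s+r≡n = m∸n+n≡m r≤n

  s+q≡p : s + (p ∸ s) ≡ p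
  s+q≡p = m+[n∸m]≡n (+-cancelʳ-≤ r s p (subst (_≤ p + r) (sym s+r≡n) (<⇒≤ (≰⇒> p+r≰n))))

  q+1<r : suc (p ∸ s) < r
  q+1<r = +-cancelˡ-< s _ _ (subst₂ _<_
    (sym (trans (+-suc s (p ∸ s)) (cong suc s+q≡p))) (sym s+r≡n) p+1<n)

theorem21 : (r : ℕ) → 2 ≤ r →
    (H : Digraph) (D : HColored H) →
    QuasiTransitive r (digraph D) →
    (∀ (C : Walk (digraph D) (suc r)) → IsCycle C → IsHCycle D C) →
    (u v : V (digraph D)) →
    (d : ℕ) → IsDistance (digraph D) u v d → r ≤ d →
    (n : ℕ) (T : Path (digraph D) u v n) → IsShortest T →
    IsHPath D (proj₁ T)
theorem21 r 2≤r H D quasi cyclesAreH u v d (_ , d-min) r≤d n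
  T@(W , joins , path) shortest = path , unobstructed
  where
  unobstructed : ∀ i → ¬ OpenObstruction D W i
  unobstructed i (p , i≡p+1 , no-arc)
    -- Minimality of the distance, applied to `T`, gives `d ≤ n` and hence `r ≤ n`.
    with window 2≤r (≤-trans r≤d (d-min n T)) (subst (_< n) i≡p+1 (toℕ<n i))
  ... | s , q , t , p≡s+q , q+1<r , s+r+t≡n
    = C-unobstructed i′ (q′ , i′≡q′+1 , λ a → no-arc (subst₂ (Arc H)
        (same-colour q′ p p≡s+q′ (subst (_< r) (sym toℕ-q′) (<⇒≤ q+1<r)))
        (same-colour i′ i i≡s+i′ (subst (_< r) (sym toℕ-i′) q+1<r)) a))
    where
    s+r≤n : s + r ≤ n
    s+r≤n = subst (s + r ≤_) s+r+t≡n (m≤m+n (s + r) t)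

    P : Path (digraph D) (at W s) (at W (s + r)) r
    P = segment W path s r s+r≤n

    backward : Arc (digraph D) (at W (s + r)) (at W s)
    backward = backward-arc 2≤r quasi T shortest s t s+r+t≡n

    C : Walk (digraph D) (suc r)
    C = close P backward

    C-unobstructed = proj₂ (cyclesAreH C (close-isCycle P backward))

    q<1+r : q < suc r
    q<1+r = m<n⇒m<1+n (<⇒≤ q+1<r)

    q+1<1+r : suc q < suc r
    q+1<1+r = m<n⇒m<1+n q+1<r

    q′ i′ : Fin (suc r)
    q′ = fromℕ< q<1+r
    i′ = fromℕ< q+1<1+r

    toℕ-q′ : toℕ q′ ≡ q
    toℕ-q′ = toℕ-fromℕ< q<1+r

    toℕ-i′ : toℕ i′ ≡ suc q
    toℕ-i′ = toℕ-fromℕ< q+1<1+r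

    i′≡q′+1 : toℕ i′ ≡ suc (toℕ q′) % suc r
    -- The two arcs meet before the cycle wraps around, so the reduction modulo `suc r` is the
    -- identity here.
    i′≡q′+1 = trans toℕ-i′ (trans (sym (m<n⇒m%n≡m q+1<1+r))
      (cong (λ k → suc k % suc r) (sym toℕ-q′)))

    p≡s+q′ : toℕ p ≡ s + toℕ q′
    p≡s+q′ = trans p≡s+q (cong (s +_) (sym toℕ-q′))

    i≡s+i′ : toℕ i ≡ s + toℕ i′
    i≡s+i′ = begin
      toℕ i          ≡⟨ i≡p+1 ⟩
      suc (toℕ p)    ≡⟨ cong suc p≡s+q ⟩
      suc (s + q)    ≡⟨ +-suc s q ⟨
      s + suc q      ≡⟨ cong (s +_) toℕ-i′ ⟨
      s + toℕ i′     ∎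
      where open ≡-Reasoning

    at-C : ∀ {k} → k ≤ r → at C k ≡ at W (s + k)
    at-C k≤r = trans (at-close P backward k≤r) (at-segment W path s r s+r≤n k≤r)

    -- The bound `toℕ j < r` excludes the closing arc of `C`, which has index `r`; every other arc
    -- of `C` is an arc of `W`.
    same-colour : ∀ (j : Fin (suc r)) (k : Fin n) → toℕ k ≡ s + toℕ j → toℕ j < r →
      colour D C j ≡ colour D W k
    same-colour j k k≡s+j j<r = colour-cong D C W j k
      (trans (at-C (<⇒≤ j<r)) (cong (at W) (sym k≡s+j)))
      (trans (at-C j<r) (cong (at W) (trans (+-suc s (toℕ j)) (cong suc (sym k≡s+j)))))
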